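{- The following graph classes are closed under reconnected complements, and their minimal graphs are as stated: (1) the class of connected graphs, whose minimal graphs are exactly the trees; (2) the class consisting of all Hamiltonian graphs together with the null graph, the single-vertex graph and the single-edge graph, whose minimal graphs are the null graph, the single-vertex graph, the single-edge graph, and the cycle graphs; (3) the class of graphs having a universal vertex, whose minimal graphs are the star graphs. Moreover, if $G$ has a universal vertex $v$ and $I\subseteq V(G)$, then $G^\ast_I$ is a complete graph if $v\in I$, and $G^\ast_I$ is a star graph if $v\notin I$.
   Context: All graphs are finite simple graphs. For $I\subseteq V(G)$, $G|_I$ denotes the induced subgraph of $G$ on $I$. The reconnected complement $G^\ast_I$ of $I$ in $G$ is the graph with vertex set $V(G)\setminus I$ in which an unordered pair $\{a,b\}\subseteq V(G)\setminus I$ ($a\neq b$) is an edge if and only if there is a path from $a$ to $b$ in $G|_{I\cup\{a,b\}}$. A graph class $\mathcal G$ is closed under reconnected complements if $G\in\mathcal G$ and $I\subseteq V(G)$ imply $G^\ast_I\in\mathcal G$. For such a class, $G\in\mathcal G$ is minimal in $\mathcal G$ if no proper spanning subgraph of $G$ lies in $\mathcal G$. A Hamiltonian graph is one containing a cycle through every vertex exactly once; a universal vertex is a vertex adjacent to all other vertices. A star graph $K_{1,m}$ is a tree with one vertex adjacent to all $m$ others and no other edges.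
   Formalization: The null graph is added to class (3) for closure (K_1 with I=V(G) gives the null graph), and to its minimal graphs. The star claim for v∉I fails for K_3, I=∅; it is replaced by: v is universal in G*_I, and G*_I is a star if G is a star. -}

module Defs where

open import Level using (0ℓ)
open import Data.Nat.Base using (ℕ; zero; suc; _≤_; z≤n; s≤s)
open import Data.Fin.Base using (Fin; zero; suc)
open import Data.Fin.Properties using (_≟_; any?; injective⇒≤)
open import Data.Fin.Subset
  using (Subset; _∈_; _⊆_; _∩_; _∪_; _─_; ⁅_⁆; Empty)
open import Data.Fin.Subset.Properties
  using (_∈?_; x∈p∩q⁺; x∈p∩q⁻; x∈p∪q⁺; x∈p∪q⁻)
open import Data.List.Base using (List; []; _∷_; length; lookup)
open import Data.List.Membership.Propositional renaming (_∈_ to _∈ₗ_) using ()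
open import Data.List.Membership.Propositional.Properties using (∈-lookup)
open import Data.List.Membership.DecPropositional using () renaming (_∈?_ to ∈ₗ-dec)
open import Data.List.Relation.Unary.All as All using (All)
open import Data.List.Relation.Unary.All.Properties using (¬Any⇒All¬)
open import Data.List.Relation.Unary.AllPairs using ([]; _∷_)
open import Data.List.Relation.Unary.Any using (here; there)
open import Data.List.Relation.Unary.Unique.Propositional using (Unique)
open import Data.Product.Base using (Σ-syntax; ∃-syntax; _×_; _,_; proj₁)
open import Data.Sum.Base using (_⊎_; inj₁; inj₂)
open import Function.Base using (_∘_)
open import Relation.Binary.Core using (Rel)
open import Relation.Binary.Definitions using (Decidable; Irreflexive; Symmetric)
open import Relation.Binary.PropositionalEquality
  using (_≡_; _≢_; refl; sym; cong)
open import Relation.Nullary using (¬_; Dec; yes; no; contradiction; ¬?)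
open import Relation.Nullary.Decidable using (map′; _×-dec_)

-- A finite simple graph whose vertex set V is a finite set of labels, namely a
-- subset of Fin n.  Every finite graph is of this form up to relabelling, and
-- deleting vertices keeps the labels of the remaining ones.
record Graph (n : ℕ) : Set₁ where
  no-eta-equality
  field
    V        : Subset n
    Adj      : Rel (Fin n) 0ℓ
    adj?     : Decidable Adj
    adj-sym  : Symmetric Adj
    adj-irr  : Irreflexive _≡_ Adj
    adj⇒∈    : ∀ {a b} → Adj a b → a ∈ V

open Graph public

------------------------------------------------------------------------
-- Walks, paths and cycles

data Walk {n} (G : Graph n) : Fin n → Fin n → Set where
  stop : ∀ {a} → a ∈ V G → Walk G a a
  step : ∀ {a b c} → Adj G a b → Walk G b c → Walk G a c

module _ {n} {G : Graph n} where

  vertices : ∀ {a b} → Walk G a b → List (Fin n)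
  vertices {a} (stop _)   = a ∷ []
  vertices {a} (step _ w) = a ∷ vertices w

  edges : ∀ {a b} → Walk G a b → List (Fin n × Fin n)
  edges (stop _)               = []
  edges (step {a} {b} _ w)     = (a , b) ∷ edges w

Path : ∀ {n} → Graph n → Fin n → Fin n → Set
Path G a b = Σ[ w ∈ Walk G a b ] Unique (vertices w)

-- A cycle, with a chosen starting point and direction: a path on at least
-- three vertices together with an edge from its end back to its start.
record Cycle {n} (G : Graph n) : Set where
  field
    start end : Fin n
    path      : Path G start end
    long      : 3 ≤ length (vertices (proj₁ path))
    closing   : Adj G end start

  cycleVertices : List (Fin n)
  cycleVertices = vertices (proj₁ path)

  cycleEdges : List (Fin n × Fin n)
  cycleEdges = (end , start) ∷ edges (proj₁ path)

open Cycle public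

------------------------------------------------------------------------
-- Decidability of the existence of a path, which is what makes the
-- adjacency of a reconnected complement decidable.

module _ {n} {G : Graph n} where

  private

    suffix : ∀ {a b c} (w : Walk G b c) → a ∈ₗ vertices w →
             Unique (vertices w) → Path G a c
    suffix (stop b∈)  (here refl) u       = stop b∈ , u
    suffix (step e w) (here refl) u       = step e w , u
    suffix (step e w) (there a∈)  (_ ∷ u) = suffix w a∈ u

    lookup-injective : ∀ {xs : List (Fin n)} → Unique xs →
                       ∀ {i j} → lookup xs i ≡ lookup xs j → i ≡ j
    lookup-injective (_ ∷ _) {zero}  {zero}  _  = refl
    lookup-injective (p ∷ _) {zero}  {suc j} eq = contradiction eq (All.lookup p (∈-lookup j))
    lookup-injective (p ∷ _) {suc i} {zero}  eq = contradiction (sym eq) (All.lookup p (∈-lookup i))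
    lookup-injective (_ ∷ u) {suc i} {suc j} eq = cong suc (lookup-injective u eq)

    walk≤? : ∀ k a b → Dec (Σ[ w ∈ Walk G a b ] length (vertices w) ≤ k)
    walk≤? zero    a b = no λ where
      (stop _   , ())
      (step _ _ , ())
    walk≤? (suc k) a b with a ≟ b ×-dec a ∈? V G
    ... | yes (refl , a∈) = yes (stop a∈ , s≤s z≤n)
    ... | no ¬stop = map′
      (λ { (_ , e , w , l) → step e w , s≤s l })
      (λ { (stop a∈ , _)       → contradiction (refl , a∈) ¬stop
         ; (step e w , s≤s l)  → _ , e , w , l })
      (any? λ c → adj? G a c ×-dec walk≤? k c b)

  walk⇒path : ∀ {a b} → Walk G a b → Path G a b
  walk⇒path (stop a∈) = stop a∈ , All.[] ∷ []
  walk⇒path {a} (step e w) with walk⇒path w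
  ... | p , u with ∈ₗ-dec _≟_ a (vertices p)
  ...   | yes a∈ = suffix p a∈ u
  ...   | no  a∉ = step e p , ¬Any⇒All¬ _ a∉ ∷ u

  path? : ∀ a b → Dec (Path G a b)
  path? a b = map′
    (walk⇒path ∘ proj₁)
    (λ (w , u) → w , injective⇒≤ (lookup-injective u))
    (walk≤? n a b)

  start∈ : ∀ {a b} → Walk G a b → a ∈ V G
  start∈ (stop a∈)  = a∈
  start∈ (step e _) = adj⇒∈ G e

  snoc : ∀ {a b c} → Walk G a b → Adj G b c → Walk G a c
  snoc (stop _)   e = step e (stop (adj⇒∈ G (adj-sym G e)))
  snoc (step f w) e = step f (snoc w e)

  reverse : ∀ {a b} → Walk G a b → Walk G b a
  reverse (stop a∈)  = stop a∈
  reverse (step e w) = snoc (reverse w) (adj-sym G e)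

------------------------------------------------------------------------
-- Induced subgraphs and reconnected complements

-- G ∣ J is the subgraph induced on V ∩ J (which is J when J ⊆ V).
infixl 6 _∣_

_∣_ : ∀ {n} → Graph n → Subset n → Graph n
V       (G ∣ J)                = V G ∩ J
Adj     (G ∣ J) a b            = Adj G a b × a ∈ J × b ∈ J
adj?    (G ∣ J) a b            = adj? G a b ×-dec a ∈? J ×-dec b ∈? J
adj-sym (G ∣ J) (e , a∈ , b∈)  = adj-sym G e , b∈ , a∈
adj-irr (G ∣ J) a≡b (e , _)    = adj-irr G a≡b e
adj⇒∈   (G ∣ J) (e , a∈ , _)   = x∈p∩q⁺ (adj⇒∈ G e , a∈)

walk-mono : ∀ {n} {G : Graph n} {J K a b} → J ⊆ K → Walk (G ∣ J) a b → Walk (G ∣ K) a b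
walk-mono {G = G} {J} J⊆K (stop a∈) with a∈V , a∈J ← x∈p∩q⁻ (V G) J a∈ =
  stop (x∈p∩q⁺ (a∈V , J⊆K a∈J))
walk-mono J⊆K (step (e , a∈ , b∈) w) = step (e , J⊆K a∈ , J⊆K b∈) (walk-mono J⊆K w)

∪⁅⁆-swap : ∀ {n} {I : Subset n} {a b} → I ∪ ⁅ a ⁆ ∪ ⁅ b ⁆ ⊆ I ∪ ⁅ b ⁆ ∪ ⁅ a ⁆
∪⁅⁆-swap {I = I} {a} {b} x∈ with x∈p∪q⁻ I (⁅ a ⁆ ∪ ⁅ b ⁆) x∈
... | inj₁ x∈I = x∈p∪q⁺ (inj₁ x∈I)
... | inj₂ x∈ab with x∈p∪q⁻ ⁅ a ⁆ ⁅ b ⁆ x∈ab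
...   | inj₁ x∈a = x∈p∪q⁺ (inj₂ (x∈p∪q⁺ (inj₂ x∈a)))
...   | inj₂ x∈b = x∈p∪q⁺ (inj₂ (x∈p∪q⁺ (inj₁ x∈b)))

-- The reconnected complement of I in G.
infixl 6 _⋆_

_⋆_ : ∀ {n} → Graph n → Subset n → Graph n
V       (G ⋆ I)     = V G ─ I
Adj     (G ⋆ I) a b =
  a ∈ V G ─ I × b ∈ V G ─ I × a ≢ b × Path (G ∣ (I ∪ ⁅ a ⁆ ∪ ⁅ b ⁆)) a b
adj?    (G ⋆ I) a b =
  a ∈? (V G ─ I) ×-dec b ∈? (V G ─ I) ×-dec ¬? (a ≟ b) ×-dec path? a b
adj-sym (G ⋆ I) (a∈ , b∈ , a≢b , w , _) =
  b∈ , a∈ , a≢b ∘ sym , walk⇒path (walk-mono (∪⁅⁆-swap {I = I}) (reverse w))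
adj-irr (G ⋆ I) a≡b (_ , _ , a≢b , _) = a≢b a≡b
adj⇒∈   (G ⋆ I) = proj₁

------------------------------------------------------------------------
-- Graph classes

GraphClass : Set₁
GraphClass = ∀ {n} → Graph n → Set

ClosedUnderRC : GraphClass → Set₁
ClosedUnderRC 𝒢 = ∀ {n} (G : Graph n) (I : Subset n) → 𝒢 G → I ⊆ V G → 𝒢 (G ⋆ I)

ProperSpanningSubgraph : ∀ {n} → Graph n → Graph n → Set
ProperSpanningSubgraph H G =
  V H ≡ V G ×
  (∀ a b → Adj H a b → Adj G a b) ×
  (∃[ a ] ∃[ b ] Adj G a b × ¬ Adj H a b)

Minimal : GraphClass → ∀ {n} → Graph n → Set₁
Minimal 𝒢 {n} G = 𝒢 G × (∀ (H : Graph n) → ProperSpanningSubgraph H G → ¬ 𝒢 H)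

IsNull : GraphClass
IsNull G = Empty (V G)

IsSingleVertex : GraphClass
IsSingleVertex G = ∃[ a ] a ∈ V G × (∀ v → v ∈ V G → v ≡ a)

IsSingleEdge : GraphClass
IsSingleEdge G = ∃[ a ] ∃[ b ] Adj G a b × (∀ v → v ∈ V G → v ≡ a ⊎ v ≡ b)

IsComplete : GraphClass
IsComplete G = ∀ a b → a ∈ V G → b ∈ V G → a ≢ b → Adj G a b

-- The null graph is connected; ClosedUnderRC forces this, as I may be all of V G.
IsConnected : GraphClass
IsConnected G = ∀ a b → a ∈ V G → b ∈ V G → Path G a b

IsTree : GraphClass
IsTree G = IsConnected G × ¬ Cycle G

Spans : ∀ {n} {G : Graph n} → Cycle G → Set
Spans {G = G} C = ∀ v → v ∈ V G → v ∈ₗ cycleVertices C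

-- As cycles have at least three vertices, so do Hamiltonian graphs.
IsHamiltonian : GraphClass
IsHamiltonian G = Σ[ C ∈ Cycle G ] Spans C

IsCycleGraph : GraphClass
IsCycleGraph G = Σ[ C ∈ Cycle G ] Spans C ×
  (∀ a b → Adj G a b → (a , b) ∈ₗ cycleEdges C ⊎ (b , a) ∈ₗ cycleEdges C)

HamiltonianOrSmall : GraphClass
HamiltonianOrSmall G = IsHamiltonian G ⊎ IsNull G ⊎ IsSingleVertex G ⊎ IsSingleEdge G

IsUniversal : ∀ {n} → Graph n → Fin n → Set
IsUniversal G v = v ∈ V G × (∀ a → a ∈ V G → a ≢ v → Adj G v a)

HasUniversalVertex : GraphClass
HasUniversalVertex G = ∃[ v ] IsUniversal G v

-- The null graph has no universal vertex, but it is G ⋆ V G for every G, so a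
-- nonempty class closed under reconnected complements has to contain it.
NullOrUniversal : GraphClass
NullOrUniversal G = IsNull G ⊎ HasUniversalVertex G

-- K_{1,m} for some m ≥ 0; the single vertex is K_{1,0}.
IsStar : GraphClass
IsStar G = IsTree G ×
  (∃[ c ] IsUniversal G c × (∀ a b → Adj G a b → a ≡ c ⊎ b ≡ c))

{-# OPTIONS --safe #-}
-- Walking along a path and skipping the vertices of I gives a path of G ⋆ I:
-- two consecutive kept vertices are joined by a stretch of the walk through I.
-- Applied to a path this gives connectedness of G ⋆ I, applied to a Hamiltonian
-- cycle started outside I it gives a Hamiltonian cycle (or one of the small
-- graphs).  For minimality of cycle graphs: every vertex of a cycle graph has at
-- most two neighbours, and every vertex of a Hamiltonian graph has at least two.
module Submission where

open import Defs
open import Data.Fin.Base using (Fin)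
open import Data.Fin.Properties using (_≟_; any?)
open import Data.Fin.Subset
  using (Subset; _∈_; _∉_; _⊆_; _∪_; _─_; ⁅_⁆; inside; outside)
open import Data.Fin.Subset.Properties
  using (_∈?_; x∈⁅x⁆; x∈⁅y⁆⇒x≡y; x∈p∪q⁺; x∈p∪q⁻; x∈p∩q⁺; x∈p∩q⁻;
         p─q⊆p; ⊆-reflexive; x∈p∧x∉q⇒x∈p─q)
open import Data.List.Base using (List; []; _∷_; _++_; filter; length)
open import Data.List.Membership.Propositional using () renaming (_∈_ to _∈ₗ_)
open import Data.List.Membership.Propositional.Properties using (∈-filter⁺)
open import Data.List.Membership.DecPropositional using () renaming (_∈?_ to ∈ₗ-dec)
open import Data.List.Relation.Binary.Permutation.Propositional
  using (_↭_; ↭-refl; ↭⇒↭ₛ)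
open import Data.List.Relation.Binary.Permutation.Propositional.Properties
  using (↭-length; ∈-resp-↭; ++-comm)
import Data.List.Relation.Binary.Permutation.Setoid.Properties as Permutationₛ
open import Data.List.Relation.Unary.All as All using (All; []; _∷_)
import Data.List.Relation.Unary.All.Properties as All
open import Data.List.Relation.Unary.AllPairs using ([]; _∷_)
open import Data.List.Relation.Unary.Any using (here; there)
open import Data.List.Relation.Unary.Unique.Propositional using (Unique)
import Data.List.Relation.Unary.Unique.Propositional.Properties as Unique
open import Data.Nat.Base using (_≤_; z≤n; s≤s)
open import Data.Product.Base
  using (Σ-syntax; ∃-syntax; ∃₂; _×_; _,_; proj₁; proj₂)
open import Data.Product.Properties using (≡-dec)
open import Data.Sum.Base using (_⊎_; inj₁; inj₂; [_,_]′; map₂; swap)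
open import Data.Vec.Base using (_∷_; here; there)
open import Function.Base using (_∘_; id)
open import Function.Bundles using (_⇔_; mk⇔)
open import Level using (0ℓ)
open import Relation.Binary.Core using (Rel)
open import Relation.Binary.Definitions using (Decidable; Symmetric)
open import Relation.Binary.PropositionalEquality
  using (_≡_; _≢_; refl; sym; trans; cong; subst; setoid)
open import Relation.Nullary using (¬_; Dec; yes; no; contradiction; ¬?)
open import Relation.Nullary.Decidable using (_×-dec_; _⊎-dec_; decidable-stable)

x∈p─q⇒x∉q : ∀ {n x} (p q : Subset n) → x ∈ p ─ q → x ∉ q
x∈p─q⇒x∉q (_ ∷ p) (inside  ∷ q) (there x∈) (there x∈q) = x∈p─q⇒x∉q p q x∈ x∈q
x∈p─q⇒x∉q (_ ∷ p) (outside ∷ q) (there x∈) (there x∈q) = x∈p─q⇒x∉q p q x∈ x∈q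

adj⇒∈ʳ : ∀ {n} (G : Graph n) {a b} → Adj G a b → b ∈ V G
adj⇒∈ʳ G e = adj⇒∈ G (adj-sym G e)

adj⇒≢ : ∀ {n} (G : Graph n) {a b} → Adj G a b → a ≢ b
adj⇒≢ G e a≡b = adj-irr G a≡b e

-- Walks

module _ {n} {G : Graph n} where

  end∈ : ∀ {a b} → Walk G a b → b ∈ V G
  end∈ (stop b∈)  = b∈
  end∈ (step _ w) = end∈ w

  infixr 5 _⧺_

  _⧺_ : ∀ {a b c} → Walk G a b → Walk G b c → Walk G a c
  stop _   ⧺ w = w
  step e v ⧺ w = step e (v ⧺ w)

  -- A shared endpoint would occur in both vertex lists; with an edge in between, the lists simply
  -- concatenate.
  vertices-⧺-step : ∀ {a b c d} (v : Walk G a b) (e : Adj G b c) (w : Walk G c d) →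
                    vertices (v ⧺ step e w) ≡ vertices v ++ vertices w
  vertices-⧺-step (stop _)   e w = refl
  vertices-⧺-step (step f v) e w = cong (_ ∷_) (vertices-⧺-step v e w)

  edges-⧺ : ∀ {a b c} (v : Walk G a b) (w : Walk G b c) →
            edges (v ⧺ w) ≡ edges v ++ edges w
  edges-⧺ (stop _)   w = refl
  edges-⧺ (step f v) w = cong (_ ∷_) (edges-⧺ v w)

  start∈vertices : ∀ {a b} (w : Walk G a b) → a ∈ₗ vertices w
  start∈vertices (stop _)   = here refl
  start∈vertices (step _ _) = here refl

  end∈vertices : ∀ {a b} (w : Walk G a b) → b ∈ₗ vertices w
  end∈vertices (stop _)   = here refl
  end∈vertices (step _ w) = there (end∈vertices w)

  vertices-nonempty : ∀ {a b} (w : Walk G a b) → 1 ≤ length (vertices w)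
  vertices-nonempty (stop _)   = s≤s z≤n
  vertices-nonempty (step _ _) = s≤s z≤n

  edges⇒vertices : ∀ {a b x y} (w : Walk G a b) → (x , y) ∈ₗ edges w →
                   x ∈ₗ vertices w × y ∈ₗ vertices w
  edges⇒vertices (step _ w) (here refl) = here refl , there (start∈vertices w)
  edges⇒vertices (step _ w) (there xy∈) with x∈ , y∈ ← edges⇒vertices w xy∈ =
    there x∈ , there y∈

  edges⇒adj : ∀ {a b x y} (w : Walk G a b) → (x , y) ∈ₗ edges w → Adj G x y
  edges⇒adj (step e _) (here refl) = e
  edges⇒adj (step _ w) (there xy∈) = edges⇒adj w xy∈

  -- The cut is at the edge entering `v`, because `rotate` needs that edge as its new closing edge.
  -- The start of the walk need not have one, hence the first alternative.
  splitAt : ∀ {a b v} (w : Walk G a b) → v ∈ₗ vertices w → a ≡ v ⊎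
            (∃[ u ] Σ[ w₁ ∈ Walk G a u ] Σ[ e ∈ Adj G u v ] Σ[ w₂ ∈ Walk G v b ]
               w ≡ w₁ ⧺ step e w₂)
  splitAt (stop _)   (here refl) = inj₁ refl
  splitAt (step _ _) (here refl) = inj₁ refl
  splitAt (step e w) (there v∈) with splitAt w v∈
  ... | inj₁ refl                    = inj₂ (_ , stop (adj⇒∈ G e) , e , w , refl)
  ... | inj₂ (_ , w₁ , f , w₂ , refl) = inj₂ (_ , step e w₁ , f , w₂ , refl)

module _ {n} {G H : Graph n} where

  -- Keeping the vertex list fixed lets uniqueness and length, and thus paths and cycles, move from
  -- `G` to `H`.
  retrace : ∀ {a b} (w : Walk G a b) → b ∈ V H →
            (∀ {x y} → (x , y) ∈ₗ edges w → Adj H x y) →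
            Σ[ v ∈ Walk H a b ] vertices v ≡ vertices w
  retrace (stop _)   b∈ _ = stop b∈ , refl
  retrace (step _ w) b∈ f with v , eq ← retrace w b∈ (f ∘ there) =
    step (f (here refl)) v , cong (_ ∷_) eq

  expand : V G ⊆ V H → (∀ {x y} → Adj G x y → Walk H x y) →
           ∀ {a b} → Walk G a b → Walk H a b
  expand G⊆H f (stop a∈)  = stop (G⊆H a∈)
  expand G⊆H f (step e w) = f e ⧺ expand G⊆H f w

-- Cycles

module _ {n} {G : Graph n} where

  -- A cycle `w₁`, `e`, `w₂` closed by `c` is also `w₂`, `c`, `w₁` closed by `e`. Permutations
  -- suffice, since uniqueness, length and membership respect them.
  rotate : (C : Cycle G) → ∀ {v} → v ∈ₗ cycleVertices C →
           Σ[ C′ ∈ Cycle G ] start C′ ≡ v ×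
             cycleVertices C ↭ cycleVertices C′ × cycleEdges C ↭ cycleEdges C′
  rotate C@(record { path = w , u ; long = l ; closing = c }) v∈ with splitAt w v∈
  ... | inj₁ refl = C , refl , ↭-refl , ↭-refl
  ... | inj₂ (_ , w₁ , e , w₂ , refl) =
    record { path    = w₂ ⧺ step c w₁ , Permutationₛ.Unique-resp-↭ (setoid _) (↭⇒↭ₛ vs) u
           ; long    = subst (3 ≤_) (↭-length vs) l
           ; closing = e }
    , refl , vs , es
    where
    vs : vertices (w₁ ⧺ step e w₂) ↭ vertices (w₂ ⧺ step c w₁)
    vs rewrite vertices-⧺-step w₁ e w₂ | vertices-⧺-step w₂ c w₁ =
      ++-comm (vertices w₁) (vertices w₂)
    -- Each side consists of the same two blocks, `c` with the edges of `w₁` and `e` with those of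
    -- `w₂`, in opposite orders.
    es : (_ , _) ∷ edges (w₁ ⧺ step e w₂) ↭ (_ , _) ∷ edges (w₂ ⧺ step c w₁)
    es rewrite edges-⧺ w₁ (step e w₂) | edges-⧺ w₂ (step c w₁) =
      ++-comm (_ ∷ edges w₁) (_ ∷ edges w₂)

  -- Pigeonhole on three distinct vertices of the cycle. Taking `a` and `b` equal excludes a single
  -- vertex as well.
  cycle⊈pair : (C : Cycle G) → ∀ {a b} →
               ¬ (∀ {x} → x ∈ₗ cycleVertices C → x ≡ a ⊎ x ≡ b)
  cycle⊈pair record { path = stop _ , _ ; long = s≤s () }
  cycle⊈pair record { path = step _ (stop _) , _ ; long = s≤s (s≤s ()) }
  cycle⊈pair record { path = step _ (step _ w) , ((p≢q ∷ p≢) ∷ q≢ ∷ _) } ab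
    with ab (here refl) | ab (there (here refl)) | ab (there (there (start∈vertices w)))
  ... | inj₁ refl | inj₁ refl | _         = p≢q refl
  ... | inj₂ refl | inj₂ refl | _         = p≢q refl
  ... | inj₁ refl | inj₂ refl | inj₁ refl = All.lookup p≢ (start∈vertices w) refl
  ... | inj₁ refl | inj₂ refl | inj₂ refl = All.lookup q≢ (start∈vertices w) refl
  ... | inj₂ refl | inj₁ refl | inj₁ refl = All.lookup q≢ (start∈vertices w) refl
  ... | inj₂ refl | inj₁ refl | inj₂ refl = All.lookup p≢ (start∈vertices w) refl

  -- After rotating `v` to the start, its neighbours on the cycle are the second and the last
  -- vertex, distinct because there are at least three. No other listed edge meets `v`, by
  -- uniqueness.
  cycleNeighbours :
    (C : Cycle G) → ∀ {v} → v ∈ₗ cycleVertices C →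
    ∃₂ λ p q → p ≢ q × Adj G v p × Adj G v q ×
      (∀ x → (v , x) ∈ₗ cycleEdges C ⊎ (x , v) ∈ₗ cycleEdges C → x ≡ p ⊎ x ≡ q)
  cycleNeighbours C v∈ with rotate C v∈
  ... | record { path = stop _ , _ ; long = s≤s () } , _
  ... | record { path = step _ (stop _) , _ ; long = s≤s (s≤s ()) } , _
  ... | record { path = step e w@(step f w′) , (v≢ ∷ p≢ ∷ _) ; closing = c } , refl , _ , es =
    _ , _ , All.lookup p≢ (end∈vertices w′) , e , adj-sym G c ,
    λ { x (inj₁ vx∈) → out (∈-resp-↭ es vx∈)
      ; x (inj₂ xv∈) → into (∈-resp-↭ es xv∈) }
    where
    out : ∀ {x} → (_ , x) ∈ₗ _ → x ≡ _ ⊎ x ≡ _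
    out (here refl) = contradiction c (adj-irr G refl)
    out (there (here refl)) = inj₁ refl
    out (there (there vx∈)) =
      contradiction refl (All.lookup v≢ (proj₁ (edges⇒vertices w vx∈)))
    into : ∀ {x} → (x , _) ∈ₗ _ → x ≡ _ ⊎ x ≡ _
    into (here refl) = inj₂ refl
    into (there (here refl)) = contradiction e (adj-irr G refl)
    into (there (there xv∈)) =
      contradiction refl (All.lookup v≢ (proj₂ (edges⇒vertices w xv∈)))

  cycleVertices⊆V : (C : Cycle G) → ∀ {x} → x ∈ₗ cycleVertices C → x ∈ V G
  cycleVertices⊆V C x∈ with _ , _ , _ , e , _ ← cycleNeighbours C x∈ = adj⇒∈ G e

  cycleEdges⇒adj : (C : Cycle G) → ∀ {x y} → (x , y) ∈ₗ cycleEdges C → Adj G x y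
  cycleEdges⇒adj C (here refl) = closing C
  cycleEdges⇒adj C (there xy∈) = edges⇒adj (proj₁ (path C)) xy∈

-- Spanning subgraphs

-- Edge lists record a direction of traversal; admitting both orientations gives the symmetry that
-- `filterEdges` demands.
Among : ∀ {n} → List (Fin n × Fin n) → Rel (Fin n) 0ℓ
Among es a b = (a , b) ∈ₗ es ⊎ (b , a) ∈ₗ es

among? : ∀ {n} (es : List (Fin n × Fin n)) → Decidable (Among es)
among? es a b = ((a , b) ∈ₑ? es) ⊎-dec ((b , a) ∈ₑ? es)
  where _∈ₑ?_ = ∈ₗ-dec (≡-dec _≟_ _≟_)

filterEdges : ∀ {n} (G : Graph n) {P : Rel (Fin n) 0ℓ} → Decidable P → Symmetric P → Graph n
V       (filterEdges G P? P-sym)             = V G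
Adj     (filterEdges G {P} P? P-sym) a b     = Adj G a b × P a b
adj?    (filterEdges G P? P-sym) a b         = adj? G a b ×-dec P? a b
adj-sym (filterEdges G P? P-sym) (e , p)     = adj-sym G e , P-sym p
adj-irr (filterEdges G P? P-sym) a≡b (e , _) = adj-irr G a≡b e
adj⇒∈   (filterEdges G P? P-sym) (e , _)     = adj⇒∈ G e

-- An edge violating `P` would make the filtered graph a proper spanning subgraph that is still in
-- the class.
minimal⇒all : ∀ (𝒢 : GraphClass) {n} {G : Graph n} {P : Rel (Fin n) 0ℓ}
              (P? : Decidable P) (P-sym : Symmetric P) →
              Minimal 𝒢 G → 𝒢 (filterEdges G P? P-sym) → ∀ a b → Adj G a b → P a b
minimal⇒all 𝒢 {G = G} P? P-sym (_ , min) h a b e =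
  decidable-stable (P? a b) λ ¬p →
    min (filterEdges G P? P-sym)
        (refl , (λ _ _ → proj₁) , a , b , e , ¬p ∘ proj₂) h

-- Reconnected complements

_∉?_ : ∀ {n} (x : Fin n) (I : Subset n) → Dec (x ∉ I)
x ∉? I = ¬? (x ∈? I)

module _ {n} {I : Subset n} where

  ∈⁅⁆ʳ : ∀ x → x ∈ I ∪ ⁅ x ⁆
  ∈⁅⁆ʳ x = x∈p∪q⁺ (inj₂ (x∈⁅x⁆ x))

  ∈∪⁅⁆⇒≡ : ∀ {x a} → x ∉ I → x ∈ I ∪ ⁅ a ⁆ → x ≡ a
  ∈∪⁅⁆⇒≡ {a = a} x∉ x∈ with x∈p∪q⁻ I ⁅ a ⁆ x∈
  ... | inj₁ x∈I = contradiction x∈I x∉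
  ... | inj₂ x∈a = x∈⁅y⁆⇒x≡y a x∈a

  ∪⁅⁆-weaken : ∀ {a b} → I ∪ ⁅ a ⁆ ⊆ I ∪ ⁅ a ⁆ ∪ ⁅ b ⁆
  ∪⁅⁆-weaken {a} x∈ with x∈p∪q⁻ I ⁅ a ⁆ x∈
  ... | inj₁ x∈I = x∈p∪q⁺ (inj₁ x∈I)
  ... | inj₂ x∈a = x∈p∪q⁺ (inj₂ (x∈p∪q⁺ (inj₁ x∈a)))

module _ {n} {G : Graph n} {I : Subset n} where

  ∈⋆⁺ : ∀ {x} → x ∈ V G → x ∉ I → x ∈ V (G ⋆ I)
  ∈⋆⁺ = x∈p∧x∉q⇒x∈p─q

  -- The stretch of a walk since its last kept vertex `a` is started by `trivial`, prolonged through
  -- `I` by `extend`, and turned into an edge of `G ⋆ I` by `bridge`.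
  trivial : ∀ {a} → a ∈ V G → Walk (G ∣ (I ∪ ⁅ a ⁆)) a a
  trivial {a} a∈ = stop (x∈p∩q⁺ (a∈ , ∈⁅⁆ʳ a))

  extend : ∀ {a u x} → Walk (G ∣ (I ∪ ⁅ a ⁆)) a u → Adj G u x → x ∈ I →
           Walk (G ∣ (I ∪ ⁅ a ⁆)) a x
  extend w e x∈I = snoc w (e , proj₂ (x∈p∩q⁻ (V G) _ (end∈ w)) , x∈p∪q⁺ (inj₁ x∈I))

  bridge : ∀ {a u x} → a ∈ V (G ⋆ I) → x ∈ V (G ⋆ I) → a ≢ x →
           Walk (G ∣ (I ∪ ⁅ a ⁆)) a u → Adj G u x → Adj (G ⋆ I) a x
  bridge {x = x} a∈ x∈ a≢x w e = a∈ , x∈ , a≢x ,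
    walk⇒path (snoc (walk-mono ∪⁅⁆-weaken w)
      ( e , ∪⁅⁆-weaken (proj₂ (x∈p∩q⁻ (V G) _ (end∈ w)))
      , x∈p∪q⁺ (inj₂ (x∈p∪q⁺ (inj₂ (x∈⁅x⁆ x))))))

  adj⇒adj-⋆ : ∀ {a b} → Adj G a b → a ∉ I → b ∉ I → Adj (G ⋆ I) a b
  adj⇒adj-⋆ e a∉ b∉ =
    bridge (∈⋆⁺ (adj⇒∈ G e) a∉) (∈⋆⁺ (adj⇒∈ʳ G e) b∉) (adj⇒≢ G e)
           (trivial (adj⇒∈ G e)) e

  -- a is the last vertex kept so far; c will be the last one kept in the end.
  contract : ∀ {a u x b} → a ∈ V (G ⋆ I) → Walk (G ∣ (I ∪ ⁅ a ⁆)) a u → Adj G u x →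
             (w : Walk G x b) → All (a ≢_) (vertices w) → Unique (vertices w) →
             ∃[ c ] Σ[ P ∈ Walk (G ⋆ I) a c ] vertices P ≡ a ∷ filter (_∉? I) (vertices w) ×
               Walk (G ∣ (I ∪ ⁅ c ⁆)) c b
  contract {x = x} a∈ d e (stop x∈V) (a≢x ∷ _) _ with x ∈? I
  -- The unfinished stretch is returned, so that a cycle can still be closed through it.
  ... | yes x∈I = _ , stop a∈ , refl , extend d e x∈I
  ... | no  x∉I = _ , step (bridge a∈ x∈ a≢x d e) (stop x∈) , refl , trivial x∈V
    where x∈ = ∈⋆⁺ x∈V x∉I
  contract {x = x} a∈ d e (step f w) (a≢x ∷ a≢) (x≢ ∷ u) with x ∈? I
  ... | yes x∈I = contract a∈ (extend d e x∈I) f w a≢ u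
  ... | no  x∉I
    with x∈ ← ∈⋆⁺ (adj⇒∈ G f) x∉I
    with c , P , eq , d′ ← contract x∈ (trivial (adj⇒∈ G f)) f w x≢ u =
      c , step (bridge a∈ x∈ a≢x d e) P , cong (_ ∷_) eq , d′

-- Closure of connected and Hamiltonian graphs.

connected-⋆ : ClosedUnderRC IsConnected
connected-⋆ G I conn _ a b a∈ b∈ with conn a b (p─q⊆p (V G) I a∈) (p─q⊆p (V G) I b∈)
... | stop _ , _ = stop a∈ , [] ∷ []
... | step e w , (a≢ ∷ u)
  with c , P , _ , d ← contract a∈ (trivial (adj⇒∈ G e)) e w a≢ u
  -- The leftover stretch lies in `I ∪ ⁅ c ⁆` and ends at `b`, which is outside `I`; so `c` is `b`.
  with refl ← ∈∪⁅⁆⇒≡ (x∈p─q⇒x∉q (V G) I b∈) (proj₂ (x∈p∩q⁻ (V G) _ (end∈ d))) =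
    walk⇒path P

-- One or two vertices give the small graphs; from three on, the ends differ and the path closes to
-- a cycle. The closing edge is conditional because a lone vertex has none.
spanningTrail⇒hamiltonianOrSmall :
  ∀ {n} {G : Graph n} {a c} (P : Walk G a c) → Unique (vertices P) →
  (∀ v → v ∈ V G → v ∈ₗ vertices P) → (c ≢ a → Adj G c a) → HamiltonianOrSmall G
spanningTrail⇒hamiltonianOrSmall {a = a} (stop a∈) _ spans _ =
  inj₂ (inj₂ (inj₁ (a , a∈ , λ v v∈ → case-[] (spans v v∈))))
  where
  case-[] : ∀ {v} → v ∈ₗ a ∷ [] → v ≡ a
  case-[] (here eq) = eq
spanningTrail⇒hamiltonianOrSmall {a = a} {c} (step e (stop c∈)) _ spans _ =
  inj₂ (inj₂ (inj₂ (a , c , e , λ v v∈ → either (spans v v∈))))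
  where
  either : ∀ {v} → v ∈ₗ a ∷ c ∷ [] → v ≡ a ⊎ v ≡ c
  either (here eq)         = inj₁ eq
  either (there (here eq)) = inj₂ eq
spanningTrail⇒hamiltonianOrSmall P@(step _ (step _ w)) u@(a≢ ∷ _) spans close =
  inj₁ (record { path = P , u ; long = s≤s (s≤s (vertices-nonempty w))
               ; closing = close (All.lookup a≢ (there (end∈vertices w)) ∘ sym) } , spans)

hamiltonianOrSmall-⋆ : ClosedUnderRC HamiltonianOrSmall
hamiltonianOrSmall-⋆ G I h I⊆ with any? (_∈? V (G ⋆ I))
... | no ∄ = inj₂ (inj₁ ∄)
hamiltonianOrSmall-⋆ G I (inj₁ (C , spans)) I⊆ | yes (s , s∈)
  -- Starting at a kept vertex `s` prevents a removed stretch from wrapping around the start.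
  with rotate C (spans s (p─q⊆p (V G) I s∈))
... | record { path = stop _ , _ ; long = s≤s () } , _
... | record { path = step e w , (a≢ ∷ u) ; closing = cl } , refl , vs , _
  with c , P , eq , d ← contract s∈ (trivial (adj⇒∈ G e)) e w a≢ u =
  spanningTrail⇒hamiltonianOrSmall P
    (subst Unique (sym eq) (All.filter⁺ (_∉? I) a≢ ∷ Unique.filter⁺ (_∉? I) u))
    (λ v v∈ → subst (v ∈ₗ_) (sym eq)
       (keep (x∈p─q⇒x∉q (V G) I v∈) (∈-resp-↭ vs (spans v (p─q⊆p (V G) I v∈)))))
    -- The stretch after the last kept vertex `c`, followed by the old closing edge, joins `c` to
    -- `s`.
    (λ c≢s → bridge (end∈ P) s∈ c≢s d cl)
  where
  keep : ∀ {v} → v ∉ I → v ∈ₗ s ∷ vertices w → v ∈ₗ s ∷ filter (_∉? I) (vertices w)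
  keep v∉ (here eq)  = here eq
  keep v∉ (there v∈) = there (∈-filter⁺ (_∉? I) v∈ v∉)
hamiltonianOrSmall-⋆ G I (inj₂ (inj₁ null)) I⊆ | yes (s , s∈) =
  contradiction (s , p─q⊆p (V G) I s∈) null
hamiltonianOrSmall-⋆ G I (inj₂ (inj₂ (inj₁ (a , a∈ , only)))) I⊆ | yes (s , s∈) =
  inj₂ (inj₂ (inj₁ (s , s∈ , λ v v∈ →
    trans (only v (p─q⊆p (V G) I v∈)) (sym (only s (p─q⊆p (V G) I s∈))))))
hamiltonianOrSmall-⋆ G I (inj₂ (inj₂ (inj₂ (a , b , e , ab)))) I⊆ | yes (s , s∈)
  with a ∈? I | b ∈? I
... | no a∉ | no b∉ =
  inj₂ (inj₂ (inj₂ (a , b , adj⇒adj-⋆ e a∉ b∉ , λ v v∈ → ab v (p─q⊆p (V G) I v∈))))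
... | yes a∈I | _ = inj₂ (inj₂ (inj₁ (s , s∈ , λ v v∈ → trans (isB v∈) (sym (isB s∈)))))
  where
  isB : ∀ {v} → v ∈ V (G ⋆ I) → v ≡ b
  isB v∈ with ab _ (p─q⊆p (V G) I v∈)
  ... | inj₁ refl = contradiction a∈I (x∈p─q⇒x∉q (V G) I v∈)
  ... | inj₂ v≡b  = v≡b
... | no _ | yes b∈I = inj₂ (inj₂ (inj₁ (s , s∈ , λ v v∈ → trans (isA v∈) (sym (isA s∈)))))
  where
  isA : ∀ {v} → v ∈ V (G ⋆ I) → v ≡ a
  isA v∈ with ab _ (p─q⊆p (V G) I v∈)
  ... | inj₁ v≡a  = v≡a
  ... | inj₂ refl = contradiction b∈I (x∈p─q⇒x∉q (V G) I v∈)

-- Reconnected complements of graphs with a universal vertex.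

universal-⋆ : ∀ {n} {G : Graph n} {v} {I : Subset n} →
              IsUniversal G v → v ∉ I → IsUniversal (G ⋆ I) v
universal-⋆ {G = G} {I = I} (v∈ , uni) v∉ = ∈⋆⁺ {G = G} v∈ v∉ , λ a a∈ a≢v →
  adj⇒adj-⋆ (uni a (p─q⊆p (V G) I a∈) a≢v) v∉ (x∈p─q⇒x∉q (V G) I a∈)

-- Any two survivors are joined by the path `a`, `v`, `b`, whose interior lies in `I`.
complete-⋆ : ∀ {n} {G : Graph n} {v} {I : Subset n} →
             IsUniversal G v → v ∈ I → IsComplete (G ⋆ I)
complete-⋆ {G = G} {v} {I} (v∈ , uni) v∈I a b a∈ b∈ a≢b =
  bridge a∈ b∈ a≢b (extend (trivial (p─q⊆p (V G) I a∈)) (adj-sym G (spoke a∈)) v∈I) (spoke b∈)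
  where
  spoke : ∀ {x} → x ∈ V (G ⋆ I) → Adj G v x
  spoke x∈ = uni _ (p─q⊆p (V G) I x∈) λ { refl → x∈p─q⇒x∉q (V G) I x∈ v∈I }

nullOrUniversal-⋆ : ClosedUnderRC NullOrUniversal
nullOrUniversal-⋆ G I h _ with any? (_∈? V (G ⋆ I))
... | no ∄ = inj₁ ∄
nullOrUniversal-⋆ G I (inj₁ null) _ | yes (s , s∈) =
  contradiction (s , p─q⊆p (V G) I s∈) null
nullOrUniversal-⋆ G I (inj₂ (v , uni)) _ | yes (s , s∈) with v ∈? I
-- The complement is complete, so any survivor `s` is universal.
... | yes v∈I = inj₂ (s , s∈ , λ a a∈ a≢s → complete-⋆ uni v∈I s a s∈ a∈ (a≢s ∘ sym))
... | no  v∉I = inj₂ (v , universal-⋆ {G = G} uni v∉I)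

-- Minimal graphs

-- Deleting the closing edge of a cycle keeps the graph connected, as the rest of the cycle is a
-- detour around it.
minimal-connected⇒tree : ∀ {n} {G : Graph n} → Minimal IsConnected G → IsTree G
minimal-connected⇒tree {G = G} min@(conn , _) = conn , acyclic
  where
  acyclic : ¬ Cycle G
  acyclic record { path = stop _ , _ ; long = s≤s () }
  acyclic record { path = step _ (stop _) , _ ; long = s≤s (s≤s ()) }
  acyclic record { start = a ; end = z ; path = w@(step e (step f w′)) , (a≢ ∷ b≢ ∷ _)
                 ; closing = cl } =
    minimal⇒all IsConnected other? (_∘ swap) min connected z a cl (inj₁ (here refl))
    where
    closingEdge = (z , a) ∷ []
    other? : Decidable (λ x y → ¬ Among closingEdge x y)
    other? x y = ¬? (among? closingEdge x y)
    H = filterEdges G other? (_∘ swap)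
    -- A path on at least three distinct vertices has no edge between its two ends.
    other : ∀ {x y} → (x , y) ∈ₗ edges w → ¬ Among closingEdge x y
    other (here refl)  (inj₁ (here refl)) = adj-irr G refl e
    other (here refl)  (inj₂ (here refl)) = All.lookup b≢ (end∈vertices w′) refl
    other (there xy∈)  (inj₁ (here refl)) =
      All.lookup a≢ (proj₂ (edges⇒vertices (step f w′) xy∈)) refl
    other (there xy∈)  (inj₂ (here refl)) =
      All.lookup a≢ (proj₁ (edges⇒vertices (step f w′) xy∈)) refl
    detour : Walk H a z
    detour = proj₁ (retrace w (adj⇒∈ G cl) λ xy∈ → edges⇒adj w xy∈ , other xy∈)
    reroute : ∀ {x y} → Adj G x y → Walk H x y
    reroute {x} {y} g with among? closingEdge x y
    ... | no  ≢cl                = step (g , ≢cl) (stop (adj⇒∈ʳ G g))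
    ... | yes (inj₁ (here refl)) = reverse detour
    ... | yes (inj₂ (here refl)) = detour
    connected : IsConnected H
    connected x y x∈ y∈ = walk⇒path (expand id reroute (proj₁ (conn x y x∈ y∈)))

-- If `H` lacks an edge of `G` but is connected, a path of `H` between the ends of that edge closes
-- with it to a cycle of `G`.
tree⇒minimal-connected : ∀ {n} {G : Graph n} → IsTree G → Minimal IsConnected G
tree⇒minimal-connected {G = G} (conn , acyclic) = conn , minimal
  where
  nonadjacent⇒long : ∀ {n} {H : Graph n} {a b} (w : Walk H a b) →
                     a ≢ b → ¬ Adj H a b → 3 ≤ length (vertices w)
  nonadjacent⇒long (stop _)            a≢b _  = contradiction refl a≢b
  nonadjacent⇒long (step f (stop _))   _   ¬f = contradiction f ¬f
  nonadjacent⇒long (step _ (step _ w)) _   _  = s≤s (s≤s (vertices-nonempty w))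
  minimal : ∀ H → ProperSpanningSubgraph H G → ¬ IsConnected H
  minimal H (V≡ , sub , a , b , e , ¬e) connH
    with w , u ← connH a b (⊆-reflexive (sym V≡) (adj⇒∈ G e)) (⊆-reflexive (sym V≡) (adj⇒∈ʳ G e))
    with w′ , eq ← retrace {H = G} w (adj⇒∈ʳ G e) (sub _ _ ∘ edges⇒adj w) =
    acyclic record
      { path    = w′ , subst Unique (sym eq) u
      ; long    = subst (λ xs → 3 ≤ length xs) (sym eq)
                    (nonadjacent⇒long w (adj⇒≢ G e) ¬e)
      ; closing = adj-sym G e }

-- Minimality of edgeless graphs, cycles and the single edge.

edgeless⇒minimal : ∀ (𝒢 : GraphClass) {n} {G : Graph n} → 𝒢 G →
                   (∀ {a b} → ¬ Adj G a b) → Minimal 𝒢 G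
edgeless⇒minimal 𝒢 g none = g , λ { _ (_ , _ , _ , _ , e , _) _ → none e }

null⇒edgeless : ∀ {n} (G : Graph n) → IsNull G → ∀ {a b} → ¬ Adj G a b
null⇒edgeless G null e = null (_ , adj⇒∈ G e)

-- The spanning cycle alone is already Hamiltonian, so minimality puts every edge of `G` on it.
minimal-hamiltonian⇒cycle : ∀ {n} {G : Graph n} → Minimal HamiltonianOrSmall G →
                            IsHamiltonian G → IsCycleGraph G
minimal-hamiltonian⇒cycle {G = G} min (C , spans) = C , spans ,
  minimal⇒all HamiltonianOrSmall onCycle? swap min
    (inj₁ (C′ , λ v → subst (v ∈ₗ_) (sym eq) ∘ spans v))
  where
  onCycle? = among? (cycleEdges C)
  H = filterEdges G onCycle? swap
  onCycle : ∀ {x y} → (x , y) ∈ₗ cycleEdges C → Adj H x y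
  onCycle xy∈ = cycleEdges⇒adj C xy∈ , inj₁ xy∈
  lifted : Σ[ w ∈ Walk H (start C) (end C) ] vertices w ≡ cycleVertices C
  lifted = retrace (proj₁ (path C)) (adj⇒∈ G (closing C)) (onCycle ∘ there)
  eq = proj₂ lifted
  C′ : Cycle H
  C′ = record { path    = proj₁ lifted , subst Unique (sym eq) (proj₂ (path C))
              ; long    = subst (λ xs → 3 ≤ length xs) (sym eq) (long C)
              ; closing = onCycle (here refl) }

cycle⇒minimal : ∀ {n} {G : Graph n} → IsCycleGraph G → Minimal HamiltonianOrSmall G
cycle⇒minimal {G = G} (C , spans , only) = inj₁ (C , spans) , minimal
  where
  V⊈pair : ∀ {a b} → ¬ (∀ v → v ∈ V G → v ≡ a ⊎ v ≡ b)
  V⊈pair ab = cycle⊈pair C λ x∈ → ab _ (cycleVertices⊆V C x∈)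
  minimal : ∀ H → ProperSpanningSubgraph H G → ¬ HamiltonianOrSmall H
  minimal H (V≡ , sub , a , b , e , ¬e) (inj₁ (D , spansD))
    with p , q , _ , _ , _ , pq ← cycleNeighbours C (spans a (adj⇒∈ G e))
    with p′ , q′ , p′≢q′ , ep′ , eq′ , _ ←
      cycleNeighbours D (spansD a (⊆-reflexive (sym V≡) (adj⇒∈ G e)))
    -- The two distinct neighbours `p′`, `q′` of `a` in `H` exhaust `p`, `q`, so one of them is `b`,
    -- against `¬e`.
    with pq b (only a b e) | pq p′ (only a p′ (sub a p′ ep′)) | pq q′ (only a q′ (sub a q′ eq′))
  ... | inj₁ refl | inj₁ refl | _         = ¬e ep′
  ... | inj₁ refl | inj₂ refl | inj₁ refl = ¬e eq′
  ... | inj₁ refl | inj₂ refl | inj₂ refl = p′≢q′ refl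
  ... | inj₂ refl | inj₂ refl | _         = ¬e ep′
  ... | inj₂ refl | inj₁ refl | inj₂ refl = ¬e eq′
  ... | inj₂ refl | inj₁ refl | inj₁ refl = p′≢q′ refl
  minimal H (V≡ , _) (inj₂ (inj₁ null)) =
    null (start C , ⊆-reflexive (sym V≡) (cycleVertices⊆V C (start∈vertices (proj₁ (path C)))))
  minimal H (V≡ , _) (inj₂ (inj₂ (inj₁ (a , _ , isA)))) =
    V⊈pair {a} {a} λ v v∈ → inj₁ (isA v (⊆-reflexive (sym V≡) v∈))
  minimal H (V≡ , _) (inj₂ (inj₂ (inj₂ (_ , _ , _ , ab)))) =
    V⊈pair λ v v∈ → ab v (⊆-reflexive (sym V≡) v∈)

singleVertex⇒edgeless : ∀ {n} (G : Graph n) → IsSingleVertex G → ∀ {a b} → ¬ Adj G a b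
singleVertex⇒edgeless G (_ , _ , only) e =
  adj-irr G (trans (only _ (adj⇒∈ G e)) (sym (only _ (adj⇒∈ʳ G e)))) e

-- A proper spanning subgraph loses the only edge but keeps two distinct vertices, which fits no
-- member of the class.
singleEdge⇒minimal : ∀ {n} {G : Graph n} → IsSingleEdge G → Minimal HamiltonianOrSmall G
singleEdge⇒minimal {G = G} small@(a , b , e , ab) = inj₂ (inj₂ (inj₂ small)) , minimal
  where
  between : ∀ {x y} → Adj G x y → (x ≡ a × y ≡ b) ⊎ (x ≡ b × y ≡ a)
  between {x} {y} f with ab x (adj⇒∈ G f) | ab y (adj⇒∈ʳ G f)
  ... | inj₁ refl | inj₁ refl = contradiction f (adj-irr G refl)
  ... | inj₁ x≡a  | inj₂ y≡b  = inj₁ (x≡a , y≡b)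
  ... | inj₂ x≡b  | inj₁ y≡a  = inj₂ (x≡b , y≡a)
  ... | inj₂ refl | inj₂ refl = contradiction f (adj-irr G refl)
  edgeless : ∀ H → ProperSpanningSubgraph H G → ∀ {x y} → ¬ Adj H x y
  edgeless H (_ , sub , _ , _ , f , ¬f) g with between f | between (sub _ _ g)
  ... | inj₁ (refl , refl) | inj₁ (refl , refl) = ¬f g
  ... | inj₁ (refl , refl) | inj₂ (refl , refl) = ¬f (adj-sym H g)
  ... | inj₂ (refl , refl) | inj₁ (refl , refl) = ¬f (adj-sym H g)
  ... | inj₂ (refl , refl) | inj₂ (refl , refl) = ¬f g
  minimal : ∀ H → ProperSpanningSubgraph H G → ¬ HamiltonianOrSmall H
  minimal H H⊂G (inj₁ (C , _))                       = edgeless H H⊂G (closing C)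
  minimal H (V≡ , _) (inj₂ (inj₁ null))                   = null (a , ⊆-reflexive (sym V≡) (adj⇒∈ G e))
  minimal H (V≡ , _) (inj₂ (inj₂ (inj₁ (_ , _ , only)))) =
    adj-irr G (trans (only a (⊆-reflexive (sym V≡) (adj⇒∈ G e)))
                     (sym (only b (⊆-reflexive (sym V≡) (adj⇒∈ʳ G e))))) e
  minimal H H⊂G (inj₂ (inj₂ (inj₂ (_ , _ , g , _)))) = edgeless H H⊂G g

-- Stars

IsCentre : ∀ {n} → Graph n → Fin n → Set
IsCentre G c = IsUniversal G c × (∀ a b → Adj G a b → a ≡ c ⊎ b ≡ c)

-- Walks go through `c`. On a cycle, a vertex other than `c` would have two distinct neighbours both
-- equal to `c`, so the cycle would consist of `c` alone.
centre⇒star : ∀ {n} {G : Graph n} {c} → IsCentre G c → IsStar G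
centre⇒star {G = G} {c} centre@((c∈ , uni) , atC) =
  ((λ a b a∈ b∈ → walk⇒path (reverse (fromCentre a∈) ⧺ fromCentre b∈)) , acyclic)
  , c , centre
  where
  fromCentre : ∀ {a} → a ∈ V G → Walk G c a
  fromCentre {a} a∈ with a ≟ c
  ... | yes refl = stop c∈
  ... | no  a≢c  = step (uni a a∈ a≢c) (stop a∈)
  acyclic : ¬ Cycle G
  acyclic C = cycle⊈pair C {c} {c} (inj₁ ∘ isCentre)
    where
    isCentre : ∀ {x} → x ∈ₗ cycleVertices C → x ≡ c
    isCentre {x} x∈ with p , q , p≢q , ep , eq , _ ← cycleNeighbours C x∈
                    with atC x p ep | atC x q eq
    ... | inj₁ x≡c | _        = x≡c
    ... | _        | inj₁ x≡c = x≡c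
    ... | inj₂ p≡c | inj₂ q≡c = contradiction (trans p≡c (sym q≡c)) p≢q

-- Keeping only the edges at `v` leaves `v` universal. The class is a parameter so that this serves
-- with and without the null graph.
minimal-universal⇒star : ∀ (𝒢 : GraphClass) → (∀ {n} {G : Graph n} → HasUniversalVertex G → 𝒢 G) →
                         ∀ {n} {G : Graph n} → Minimal 𝒢 G → HasUniversalVertex G → IsStar G
minimal-universal⇒star 𝒢 universal⇒𝒢 {G = G} min (v , v∈ , uni) =
  centre⇒star {G = G} ((v∈ , uni) ,
    minimal⇒all 𝒢 (λ a b → (a ≟ v) ⊎-dec (b ≟ v)) swap min
      (universal⇒𝒢 (v , v∈ , λ a a∈ a≢v → uni a a∈ a≢v , inj₁ refl)))

-- Suppose `H` lacks the spoke from `c` to `x`. Its universal vertex `u` is then neither end, and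
-- the edge from `u` to `x` would be an edge of the star avoiding `c`.
star⇒minimal-universal : ∀ {n} {G : Graph n} → IsStar G → Minimal HasUniversalVertex G
star⇒minimal-universal {G = G} (_ , c , (c∈ , uni) , atC) = (c , c∈ , uni) , minimal
  where
  minimal : ∀ H → ProperSpanningSubgraph H G → ¬ HasUniversalVertex H
  minimal H (V≡ , sub , a , b , e , ¬e) (u , _ , uniH) =
    [ (λ { refl → present e ¬e })
    , (λ { refl → present (adj-sym G e) (¬e ∘ adj-sym H) }) ]′ (atC a b e)
    where
    present : ∀ {x} → Adj G c x → ¬ ¬ Adj H c x
    present {x} f ¬f with u ≟ c | x ≟ u
    ... | yes refl | _        = ¬f (uniH x (⊆-reflexive (sym V≡) (adj⇒∈ʳ G f)) (adj⇒≢ G f ∘ sym))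
    ... | no u≢c   | yes refl = ¬f (adj-sym H (uniH c (⊆-reflexive (sym V≡) c∈) (u≢c ∘ sym)))
    ... | no u≢c   | no x≢u
      with atC u x (sub u x (uniH x (⊆-reflexive (sym V≡) (adj⇒∈ʳ G f)) x≢u))
    ...   | inj₁ u≡c = u≢c u≡c
    ...   | inj₂ x≡c = adj⇒≢ G f (sym x≡c)

star⇒minimal-nullOrUniversal : ∀ {n} {G : Graph n} → IsStar G → Minimal NullOrUniversal G
star⇒minimal-nullOrUniversal star@(_ , c , (c∈ , _) , _)
  with universal , minimal ← star⇒minimal-universal star =
  inj₂ universal , λ where
    H (V≡ , _) (inj₁ null) → null (c , ⊆-reflexive (sym V≡) c∈)
    H H⊂G (inj₂ uniH) → minimal H H⊂G uniH

-- That `G` is a star has to be assumed: for empty `I` the reconnected complement has the same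
-- vertices and edges as `G`, which may be any graph with a universal vertex.
star-⋆ : ∀ {n} {G : Graph n} {v} {I : Subset n} →
         IsUniversal G v → v ∉ I → IsStar G → IsStar (G ⋆ I)
star-⋆ {G = G} {v} {I} uni v∉ (_ , c , _ , atC) =
  centre⇒star {G = G ⋆ I}
    (universal-⋆ {G = G} uni v∉ , λ { a b (_ , _ , a≢b , w , _) → through a≢b w })
  where
  -- The universal vertex `v` may differ from the given centre `c`, as in a single edge, but it is a
  -- centre too.
  atV : ∀ a b → Adj G a b → a ≡ v ⊎ b ≡ v
  atV a b e with a ≟ v | b ≟ v
  ... | yes a≡v | _       = inj₁ a≡v
  ... | _       | yes b≡v = inj₂ b≡v
  ... | no a≢v  | no b≢v
    with atC v a (proj₂ uni a (adj⇒∈ G e) a≢v) | atC v b (proj₂ uni b (adj⇒∈ʳ G e) b≢v)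
  ...   | inj₁ refl | _         = atC a b e
  ...   | _         | inj₁ refl = atC a b e
  ...   | inj₂ refl | inj₂ refl = contradiction e (adj-irr G refl)
  through : ∀ {a b} → a ≢ b → Walk (G ∣ (I ∪ ⁅ a ⁆ ∪ ⁅ b ⁆)) a b → a ≡ v ⊎ b ≡ v
  through a≢b (stop _) = contradiction refl a≢b
  -- The first edge has `v` as an end. If it arrives at `v`, then `v` is `a` or `b`, because the
  -- walk stays in `I ∪ ⁅ a ⁆ ∪ ⁅ b ⁆` and `v` is outside `I`.
  through {a} {b} _ (step {b = x} (e , _ , x∈) _) with atV a x e
  ... | inj₁ a≡v = inj₁ a≡v
  ... | inj₂ refl with x∈p∪q⁻ I (⁅ a ⁆ ∪ ⁅ b ⁆) x∈
  ...   | inj₁ v∈I = contradiction v∈I v∉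
  ...   | inj₂ v∈ab with x∈p∪q⁻ ⁅ a ⁆ ⁅ b ⁆ v∈ab
  ...     | inj₁ v∈a = inj₁ (sym (x∈⁅y⁆⇒x≡y a v∈a))
  ...     | inj₂ v∈b = inj₂ (sym (x∈⁅y⁆⇒x≡y b v∈b))

mainTheorem2 : ( ClosedUnderRC IsConnected
    × (∀ {n} (G : Graph n) → Minimal IsConnected G ⇔ IsTree G) )
    ×
    ( ClosedUnderRC HamiltonianOrSmall
    × (∀ {n} (G : Graph n) → Minimal HamiltonianOrSmall G ⇔
    (IsNull G ⊎ IsSingleVertex G ⊎ IsSingleEdge G ⊎ IsCycleGraph G)) )
    ×
    ( ClosedUnderRC NullOrUniversal
    × (∀ {n} (G : Graph n) → Minimal NullOrUniversal G ⇔ (IsNull G ⊎ IsStar G))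
    × (∀ {n} (G : Graph n) → Minimal HasUniversalVertex G ⇔ IsStar G) )
    ×
    (∀ {n} (G : Graph n) (v : Fin n) (I : Subset n) → IsUniversal G v → I ⊆ V G →
    (v ∈ I → IsComplete (G ⋆ I))
    × (v ∉ I → IsUniversal (G ⋆ I) v × (IsStar G → IsStar (G ⋆ I))))
mainTheorem2 =
    (connected-⋆ , λ G → mk⇔ minimal-connected⇒tree tree⇒minimal-connected)
  , (hamiltonianOrSmall-⋆ , λ G → mk⇔
      (λ min → [ inj₂ ∘ inj₂ ∘ inj₂ ∘ minimal-hamiltonian⇒cycle min
             , map₂ (map₂ inj₁) ]′ (proj₁ min))
      [ (λ null → edgeless⇒minimal HamiltonianOrSmall (inj₂ (inj₁ null)) (null⇒edgeless G null))
      , [ (λ one → edgeless⇒minimal HamiltonianOrSmall (inj₂ (inj₂ (inj₁ one)))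
                     (singleVertex⇒edgeless G one))
        , [ singleEdge⇒minimal , cycle⇒minimal ]′ ]′ ]′)
  , (nullOrUniversal-⋆
    , (λ G → mk⇔
        (λ min → map₂ (minimal-universal⇒star NullOrUniversal inj₂ min) (proj₁ min))
        [ (λ null → edgeless⇒minimal NullOrUniversal {G = G} (inj₁ null) (null⇒edgeless G null))
        , star⇒minimal-nullOrUniversal ]′)
    , λ G → mk⇔
        (λ min → minimal-universal⇒star HasUniversalVertex id min (proj₁ min))
        star⇒minimal-universal)
  , λ G v I uni _ → complete-⋆ {G = G} uni
                , λ v∉ → universal-⋆ {G = G} uni v∉ , star-⋆ {G = G} uni v∉
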